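{- Let $\epsilon>0$. For all but finitely many triples $(a,b,c)$ of coprime integers larger than $1$ satisfying $a+b=c$, there is $\psi\in\mathscr{T}(a,b)$ with $\|\psi\|<c^{\frac12+\epsilon}$ such that not all of the integers $\mathrm{d}^\psi(a)$, $\mathrm{d}^\psi(b)$, $\mathrm{d}^\psi(c)$ are zero.
   Context: For a prime $p$, $v_p$ is the $p$-adic valuation. For a non-zero integer $n$, $\mathrm{supp}(n)$ is the set of primes dividing $n$. Let $\Omega$ be the free $\mathbb{Z}$-module on symbols $\xi_p$, one for each prime $p$. Define $\mathrm{d}:\mathbb{Z}\to\Omega$ by $\mathrm{d}0=0$ and $\mathrm{d}n=\sum_{p\mid n}\frac{n\,v_p(n)}{p}\,\xi_p$ for $n\ne 0$ (the coefficients are integers). For a $\mathbb{Z}$-linear map $\psi:\Omega\to\mathbb{Z}$ put $\|\psi\|=\sup_p|\psi(\xi_p)|$. Let $\mathscr{T}$ be the $\mathbb{Z}$-module of all $\mathbb{Z}$-linear $\psi:\Omega\to\mathbb{Z}$ with $\|\psi\|<\infty$. For $\psi\in\mathscr{T}$ let $\mathrm{d}^\psi=\psi\circ\mathrm{d}:\mathbb{Z}\to\mathbb{Z}$ and $\mathrm{supp}(\psi)=\{p:\psi(\xi_p)\neq0\}$. For positive integers $a,b$, $$\mathscr{T}(a,b)=\{\psi\in\mathscr{T}:\ \mathrm{supp}(\psi)\subseteq\mathrm{supp}(ab(a+b))\ \text{and}\ \mathrm{d}^\psi(a+b)=\mathrm{d}^\psi a+\mathrm{d}^\psi b\}.$$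 -}

module Defs where

open import Level using (0ℓ)
open import Algebra.Module.Bundles using (LeftModule)
import Algebra.Module.Construct.TensorUnit as TensorUnit
open import Algebra.Module.Morphism.Structures using (module LeftModuleMorphisms)
open import Data.Bool.Base using (if_then_else_)
open import Data.Integer.Base as ℤ using (ℤ; +_; -[1+_]; 0ℤ; 1ℤ; ∣_∣)
import Data.Integer.DivMod as ℤ
import Data.Integer.Divisibility as ℤ
import Data.Integer.Properties as ℤ
open import Data.Irrelevant using ([_])
open import Data.Nat.Base as ℕ using (ℕ; zero; suc; NonZero; _⊔_)
import Data.Nat.Divisibility as ℕ
import Data.Nat.DivMod as ℕ
import Data.Nat.Properties as ℕ
open import Data.Nat.Primality using (Prime; prime⇒nonZero)
open import Data.Product.Base using (∃-syntax; _×_; _,_)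
open import Data.Rational.Base as ℚ using (ℚ; mkℚ)
import Data.Rational.Properties as ℚ
open import Data.Refinement using (_,_; Refinement-syntax; value)
open import Data.Sum.Base using (_⊎_; inj₁; inj₂)
open import Function.Bundles using (_⇔_; mk⇔; module Equivalence)
open import Relation.Binary.PropositionalEquality
open import Relation.Nullary using (¬_; does; yes; no; contradiction)
open import Relation.Nullary.Decidable using (dec-false; recompute)
open import Relation.Unary using (Pred; _⊆_)

-- A refinement (with irrelevant primality proof) rather than Σ ℕ Prime, so
-- that equality of primes is equality of numbers.
ℙ : Set
ℙ = [ p ∈ ℕ ∣ Prime p ]

ℙ-nonZero : (p : ℙ) → NonZero (value p)
ℙ-nonZero (p , [ pr ]) = recompute (ℕ.nonZero? p) (prime⇒nonZero pr)

-- The largest k ≤ b with p ^ k ∣ n.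
maxPower : (b p n : ℕ) → ℕ
maxPower zero    p n = zero
maxPower (suc b) p n with p ℕ.^ suc b ℕ.∣? n
... | yes _ = suc b
... | no  _ = maxPower b p n

-- For n > 0 every k with p ^ k ∣ n satisfies k < p ^ k ≤ n, so b = n is a
-- sufficient bound.  The value v p 0 is junk.
v : ℙ → ℕ → ℕ
v p n = maxPower n (value p) n

-- The free ℤ-module on the symbols ξ p is realised as the module of finitely
-- supported families of integers indexed by the primes: the family x stands
-- for the sum of the coeff x p · ξ p.  The bound is only a witness of finite
-- support; equality compares coefficients.
record ∣Ω∣ : Set where
  field
    coeff     : ℙ → ℤ
    bound     : ℕ
    supported : ∀ p → bound ℕ.< value p → coeff p ≡ 0ℤ
open ∣Ω∣ public

Ω : LeftModule ℤ.+-*-ring 0ℓ 0ℓ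
Ω = record
  { Carrierᴹ = ∣Ω∣
  ; _≈ᴹ_     = _≈_
  ; _+ᴹ_     = _+_
  ; _*ₗ_     = _·_
  ; 0ᴹ       = 0#
  ; -ᴹ_      = neg
  ; isLeftModule = record
    { isLeftSemimodule = record
      { +ᴹ-isCommutativeMonoid = record
        { isMonoid = record
          { isSemigroup = record
            { isMagma = record
              { isEquivalence = record
                { refl  = λ p → refl
                ; sym   = λ x≈y p → sym (x≈y p)
                ; trans = λ x≈y y≈z p → trans (x≈y p) (y≈z p)
                }
              ; ∙-cong = λ x≈y u≈v p → cong₂ ℤ._+_ (x≈y p) (u≈v p)
              }
            ; assoc = λ x y z p → ℤ.+-assoc (coeff x p) (coeff y p) (coeff z p)
            }
          ; identity = (λ x p → ℤ.+-identityˡ (coeff x p))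
                     , (λ x p → ℤ.+-identityʳ (coeff x p))
          }
        ; comm = λ x y p → ℤ.+-comm (coeff x p) (coeff y p)
        }
      ; isPreleftSemimodule = record
        { *ₗ-cong      = λ k≡l x≈y p → cong₂ ℤ._*_ k≡l (x≈y p)
        ; *ₗ-zeroˡ     = λ x p → ℤ.*-zeroˡ (coeff x p)
        ; *ₗ-distribʳ  = λ x k l p → ℤ.*-distribʳ-+ (coeff x p) k l
        ; *ₗ-identityˡ = λ x p → ℤ.*-identityˡ (coeff x p)
        ; *ₗ-assoc     = λ k l x p → ℤ.*-assoc k l (coeff x p)
        ; *ₗ-zeroʳ     = λ k p → ℤ.*-zeroʳ k
        ; *ₗ-distribˡ  = λ k x y p → ℤ.*-distribˡ-+ k (coeff x p) (coeff y p)
        }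
      }
    ; -ᴹ‿cong    = λ x≈y p → cong ℤ.-_ (x≈y p)
    ; -ᴹ‿inverse = (λ x p → ℤ.+-inverseˡ (coeff x p))
                 , (λ x p → ℤ.+-inverseʳ (coeff x p))
    }
  }
  where
  _≈_ : ∣Ω∣ → ∣Ω∣ → Set
  x ≈ y = ∀ p → coeff x p ≡ coeff y p

  _+_ : ∣Ω∣ → ∣Ω∣ → ∣Ω∣
  x + y = record
    { coeff     = λ p → coeff x p ℤ.+ coeff y p
    ; bound     = bound x ⊔ bound y
    ; supported = λ p b<p → cong₂ ℤ._+_
        (supported x p (ℕ.≤-<-trans (ℕ.m≤m⊔n (bound x) (bound y)) b<p))
        (supported y p (ℕ.≤-<-trans (ℕ.m≤n⊔m (bound x) (bound y)) b<p))
    }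

  _·_ : ℤ → ∣Ω∣ → ∣Ω∣
  k · x = record
    { coeff     = λ p → k ℤ.* coeff x p
    ; bound     = bound x
    ; supported = λ p b<p →
        trans (cong (k ℤ.*_) (supported x p b<p)) (ℤ.*-zeroʳ k)
    }

  0# : ∣Ω∣
  0# = record { coeff = λ _ → 0ℤ ; bound = 0 ; supported = λ _ _ → refl }

  neg : ∣Ω∣ → ∣Ω∣
  neg x = record
    { coeff     = λ p → ℤ.- coeff x p
    ; bound     = bound x
    ; supported = λ p b<p → cong ℤ.-_ (supported x p b<p)
    }

ξ : ℙ → ∣Ω∣
ξ p = record
  { coeff     = λ q → if does (value q ℕ.≟ value p) then 1ℤ else 0ℤ
  ; bound     = value p
  ; supported = λ q p<q → cong (if_then 1ℤ else 0ℤ)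
      (dec-false (value q ℕ.≟ value p) (ℕ.>⇒≢ p<q))
  }

-- The coefficient n · vₚ(n) / p; the division is exact by ∂-exact.
∂ : ℤ → ℙ → ℤ
∂ n p = ℤ._/ℕ_ (n ℤ.* + v p ∣ n ∣) (value p) {{ℙ-nonZero p}}

private
  maxPower≡0⊎∣ : ∀ b p n → maxPower b p n ≡ 0 ⊎ p ℕ.∣ n
  maxPower≡0⊎∣ zero    p n = inj₁ refl
  maxPower≡0⊎∣ (suc b) p n with p ℕ.^ suc b ℕ.∣? n
  ... | yes pᵇ∣n = inj₂ (ℕ.∣-trans (ℕ.m∣m*n (p ℕ.^ b)) pᵇ∣n)
  ... | no  _    = maxPower≡0⊎∣ b p n

  v≡0⊎∣ : ∀ p n → v p n ≡ 0 ⊎ value p ℕ.∣ n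
  v≡0⊎∣ p n = maxPower≡0⊎∣ n (value p) n

  %ℕ≡0 : ∀ k d .{{_ : NonZero d}} → d ℕ.∣ ∣ k ∣ → k ℤ.%ℕ d ≡ 0
  %ℕ≡0 (+ k)    d d∣k = ℕ.n∣m⇒m%n≡0 k d d∣k
  %ℕ≡0 -[1+ k ] d d∣k with suc k ℕ.% d | ℕ.n∣m⇒m%n≡0 (suc k) d d∣k
  ... | zero | _ = refl

  p∣n·v : ∀ n p → value p ℕ.∣ ∣ n ℤ.* + v p ∣ n ∣ ∣
  p∣n·v n p rewrite ℤ.abs-* n (+ v p ∣ n ∣) with v≡0⊎∣ p (∣ n ∣)
  ... | inj₁ v≡0 rewrite v≡0 | ℕ.*-zeroʳ (∣ n ∣) = value p ℕ.∣0
  ... | inj₂ p∣n = ℕ.∣m⇒∣m*n (v p (∣ n ∣)) p∣n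

  ∂≡0 : ∀ n p → n ℤ.* + v p ∣ n ∣ ≡ 0ℤ → ∂ n p ≡ 0ℤ
  ∂≡0 n p nv≡0 rewrite nv≡0 = cong +_ (ℕ.0/n≡0 (value p) {{ℙ-nonZero p}})

  nv≡0 : ∀ n p → ∣ n ∣ ℕ.< value p → n ℤ.* + v p ∣ n ∣ ≡ 0ℤ
  nv≡0 n p n<p with v≡0⊎∣ p (∣ n ∣)
  nv≡0 n          p n<p | inj₁ v≡0 rewrite v≡0 = ℤ.*-zeroʳ n
  nv≡0 (+ 0)      p n<p | inj₂ p∣n = ℤ.*-zeroˡ (+ v p 0)
  nv≡0 (+ suc _)  p n<p | inj₂ p∣n = contradiction p∣n (ℕ.>⇒∤ n<p)
  nv≡0 (-[1+ _ ]) p n<p | inj₂ p∣n = contradiction p∣n (ℕ.>⇒∤ n<p)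

∂-exact : ∀ n p → ∂ n p ℤ.* + value p ≡ n ℤ.* + v p ∣ n ∣
∂-exact n p = sym (begin
  m                                             ≡⟨ ℤ.a≡a%ℕn+[a/ℕn]*n m (value p) ⟩
  + (m ℤ.%ℕ value p) ℤ.+ ∂ n p ℤ.* + value p    ≡⟨ cong (λ r → + r ℤ.+ ∂ n p ℤ.* + value p)
                                                        (%ℕ≡0 m (value p) (p∣n·v n p)) ⟩
  0ℤ ℤ.+ ∂ n p ℤ.* + value p                    ≡⟨ ℤ.+-identityˡ _ ⟩
  ∂ n p ℤ.* + value p                           ∎)
  where
  open ≡-Reasoning
  instance
    _ : NonZero (value p)
    _ = ℙ-nonZero p
  m : ℤ
  m = n ℤ.* + v p ∣ n ∣

-- The coefficients at primes not dividing n vanish because vₚ(n) = 0 there, and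
-- those of d 0 vanish because of the factor n.
d : ℤ → ∣Ω∣
d n = record
  { coeff     = ∂ n
  ; bound     = ∣ n ∣
  ; supported = λ p n<p → ∂≡0 n p (nv≡0 n p n<p)
  }

d-0 : let open LeftModule Ω in d 0ℤ ≈ᴹ 0ᴹ
d-0 p = ∂≡0 0ℤ p (ℤ.*-zeroˡ (+ v p 0))

open LeftModuleMorphisms
  (LeftModule.rawLeftModule Ω)
  (LeftModule.rawLeftModule (TensorUnit.leftModule {R = ℤ.+-*-ring}))
  using (IsLeftModuleHomomorphism)

record 𝒯 : Set where
  field
    ⟦_⟧      : ∣Ω∣ → ℤ
    isLinear : IsLeftModuleHomomorphism ⟦_⟧
    bounded  : ∃[ M ] ∀ p → ∣ ⟦ ξ p ⟧ ∣ ℕ.≤ M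
open 𝒯 public

-- ‖ψ‖ is given by its graph: ‖ ψ ‖≡ M says that M is the least upper bound of
-- the values ∣ψ(ξ p)∣.  As these are integers, the supremum is a natural
-- number, but it is not computable from ψ.
infix 4 ‖_‖≡_
‖_‖≡_ : 𝒯 → ℕ → Set
‖ ψ ‖≡ M = UpperBound M × (∀ M′ → UpperBound M′ → M ℕ.≤ M′)
  where
  UpperBound : ℕ → Set
  UpperBound B = ∀ p → ∣ ⟦ ψ ⟧ (ξ p) ∣ ℕ.≤ B

d[_] : 𝒯 → ℤ → ℤ
d[ ψ ] n = ⟦ ψ ⟧ (d n)

supp : ℤ → Pred ℙ 0ℓ
supp n p = + value p ℤ.∣ n

supp𝒯 : 𝒯 → Pred ℙ 0ℓ
supp𝒯 ψ p = ⟦ ψ ⟧ (ξ p) ≢ 0ℤ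

𝒯⟨_,_⟩ : ℕ → ℕ → Pred 𝒯 0ℓ
𝒯⟨ a , b ⟩ ψ =
    supp𝒯 ψ ⊆ supp (+ (a ℕ.* b ℕ.* (a ℕ.+ b)))
  × d[ ψ ] (+ (a ℕ.+ b)) ≡ d[ ψ ] (+ a) ℤ.+ d[ ψ ] (+ b)

-- Dedekind real numbers.
record ℝ : Set₁ where
  field
    L U         : Pred ℚ 0ℓ
    L-inhabited : ∃[ q ] L q
    U-inhabited : ∃[ q ] U q
    L-rounded   : ∀ q → L q ⇔ (∃[ r ] q ℚ.< r × L r)
    U-rounded   : ∀ r → U r ⇔ (∃[ q ] q ℚ.< r × U q)
    disjoint    : ∀ q → ¬ (L q × U q)
    located     : ∀ {q r} → q ℚ.< r → L q ⊎ U r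

infix 4 _<ℝ_
_<ℝ_ : ℚ → ℝ → Set
q <ℝ x = ℝ.L x q

infixl 6 _+ℝ_
_+ℝ_ : ℚ → ℝ → ℝ
s +ℝ x = record
  { L           = λ q → L (q ℚ.- s)
  ; U           = λ q → U (q ℚ.- s)
  ; L-inhabited = let q , Lq = L-inhabited in q ℚ.+ s , subst L (sym (+s-s q)) Lq
  ; U-inhabited = let q , Uq = U-inhabited in q ℚ.+ s , subst U (sym (+s-s q)) Uq
  ; L-rounded   = λ q → mk⇔
      (λ Lq → let r , q<r , Lr = to (L-rounded (q ℚ.- s)) Lq in
        r ℚ.+ s , subst (ℚ._< r ℚ.+ s) (-s+s q) (ℚ.+-monoˡ-< s q<r)
                , subst L (sym (+s-s r)) Lr)
      (λ (r , q<r , Lr) →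
        from (L-rounded (q ℚ.- s)) (r ℚ.- s , ℚ.+-monoˡ-< (ℚ.- s) q<r , Lr))
  ; U-rounded   = λ r → mk⇔
      (λ Ur → let q , q<r , Uq = to (U-rounded (r ℚ.- s)) Ur in
        q ℚ.+ s , subst (q ℚ.+ s ℚ.<_) (-s+s r) (ℚ.+-monoˡ-< s q<r)
                , subst U (sym (+s-s q)) Uq)
      (λ (q , q<r , Uq) →
        from (U-rounded (r ℚ.- s)) (q ℚ.- s , ℚ.+-monoˡ-< (ℚ.- s) q<r , Uq))
  ; disjoint    = λ q → disjoint (q ℚ.- s)
  ; located     = λ q<r → located (ℚ.+-monoˡ-< (ℚ.- s) q<r)
  }
  where
  open ℝ x
  open Equivalence using (to; from)
  +s-s : ∀ q → (q ℚ.+ s) ℚ.- s ≡ q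
  +s-s q = trans (ℚ.+-assoc q s (ℚ.- s))
                 (trans (cong (q ℚ.+_) (ℚ.+-inverseʳ s)) (ℚ.+-identityʳ q))
  -s+s : ∀ q → (q ℚ.- s) ℚ.+ s ≡ q
  -s+s q = trans (ℚ.+-assoc q (ℚ.- s) s)
                 (trans (cong (q ℚ.+_) (ℚ.+-inverseˡ s)) (ℚ.+-identityʳ q))

-- n < c ^ q for c > 0: raise both sides to the power of the denominator of q,
-- and clear c from the denominator if q is negative.
infix 4 _<_^ℚ_ _<_^ℝ_
_<_^ℚ_ : ℕ → ℕ → ℚ → Set
n < c ^ℚ mkℚ (+ k)    t-1 _ = n ℕ.^ suc t-1 ℕ.< c ℕ.^ k
n < c ^ℚ mkℚ -[1+ k ] t-1 _ = n ℕ.^ suc t-1 ℕ.* c ℕ.^ suc k ℕ.< 1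

-- For c ≥ 1, c ^ x is the supremum of c ^ q over the rationals q < x, so n lies
-- strictly below it exactly when n < c ^ q for some such q.
_<_^ℝ_ : ℕ → ℕ → ℝ → Set
n < c ^ℝ x = ∃[ q ] (q <ℝ x × n < c ^ℚ q)

{-# OPTIONS --safe #-}

-- Pick one prime p ∣ a, q ∣ b, r ∣ c and look for ψ supported on {p, q, r}.  The
-- numbers a, b, c are pairwise coprime, so p, q, r are distinct and the
-- additivity condition is one homogeneous linear equation A x + B y = C z in
-- three unknowns, with non-zero coefficients A = a vₚ(a) / p etc.  Hence every
-- non-zero solution gives a ψ not annihilating all of d a, d b, d c.  By the
-- pigeonhole principle there is one of size H = ⌊√(A + B + C)⌋, and
-- 2 A ≤ a log₂ a etc. yields H² ≤ c log₂ c.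
module Submission where

open import Defs
open import Algebra.Module.Bundles using (LeftModule)
import Algebra.Module.Construct.TensorUnit as TensorUnit
open import Algebra.Module.Morphism.Structures using (module LeftModuleMorphisms)
open import Data.Bool.Base using (if_then_else_)
open import Data.Fin.Base as Fin using (Fin; toℕ; fromℕ<; combine; remQuot)
import Data.Fin.Properties as Fin
open import Data.Integer.Base as ℤ using (ℤ; +_; -[1+_]; 0ℤ; 1ℤ; ∣_∣)
import Data.Integer.Properties as ℤ
open import Data.Integer.Tactic.RingSolver using () renaming (solve-∀ to ℤ-solve-∀)
open import Data.Irrelevant using ([_])
open import Data.List.Base using (List; []; _∷_; upTo; cartesianProduct)
open import Data.List.Membership.Propositional using (_∉_)
open import Data.List.Membership.Propositional.Properties
  using (∈-cartesianProduct⁺; ∈-upTo⁺)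
open import Data.List.Relation.Unary.All using (_∷_)
open import Data.Nat.Base as ℕ
  using (ℕ; zero; suc; _+_; _*_; _^_; _⊔_; _≤_; _<_; s≤s; z≤n; NonZero)
open import Data.Nat.DivMod using (_/_; _%_; m≡m%n+[m/n]*n; m%n<n; m/n*n≤m)
open import Data.Nat.Divisibility
  using (_∣_; _∤_; _∣?_; ∣⇒≤; ∣-trans; ∣m∣n⇒∣m+n; ∣m+n∣m⇒∣n; ∣m⇒∣m*n; ∣n⇒∣m*n; m∣m*n; 1∣_)
open import Data.Nat.GCD using (gcd; gcd-greatest)
open import Data.Nat.Primality using (Prime; prime⇒nonTrivial)
open import Data.Nat.Primality.Factorisation using (PrimeFactorisation; factorise)
import Data.Nat.Properties as ℕ
open import Data.Nat.Tactic.RingSolver using (solve-∀)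
open import Data.Product.Base using (Σ-syntax; ∃-syntax; _×_; _,_; proj₁; proj₂; uncurry)
open import Data.Rational.Base as ℚ using (ℚ; mkℚ; 0ℚ; ½)
import Data.Rational.Properties as ℚ
open import Data.Refinement using (_,_; value)
open import Data.Sum.Base using (inj₁; inj₂)
open import Function.Base using (_∘_)
open import Function.Bundles using (module Equivalence)
open import Relation.Binary.PropositionalEquality
open import Relation.Nullary using (¬_; yes; no; contradiction)
open import Relation.Nullary.Decidable using (dec-true; dec-false; recompute)

-- Integer square roots and Siegel's lemma by pigeonhole.

isqrt : ∀ n → ∃[ h ] (h * h ≤ n × n < suc h * suc h)
isqrt zero = 0 , z≤n , s≤s z≤n
isqrt (suc n) with isqrt n
... | h , h²≤n , n<[1+h]² with suc n ℕ.<? suc h * suc h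
...   | yes 1+n<[1+h]² = h , ℕ.m≤n⇒m≤1+n h²≤n , 1+n<[1+h]²
...   | no  1+n≮[1+h]² = suc h , ℕ.≮⇒≥ 1+n≮[1+h]² ,
  ℕ.≤-<-trans n<[1+h]² (ℕ.*-mono-< (ℕ.n<1+n (suc h)) (ℕ.n<1+n (suc h)))

remQuot-injective : ∀ {m} n {i j : Fin (m * n)} → remQuot {m} n i ≡ remQuot {m} n j → i ≡ j
remQuot-injective {m} n {i} {j} eq = trans (sym (Fin.combine-remQuot {m} n i))
  (trans (cong (uncurry combine) eq) (Fin.combine-remQuot {m} n j))

-- Points of the box are coded by a single index because `Fin.pigeonhole` speaks of maps between
-- `Fin` types; injectivity of the decoding makes distinct indices distinct points.
remQuot₃ : ∀ {l m} n → Fin (l * (m * n)) → Fin l × Fin m × Fin n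
remQuot₃ {l} {m} n i =
  proj₁ (remQuot {l} (m * n) i) , remQuot {m} n (proj₂ (remQuot {l} (m * n) i))

remQuot₃-injective : ∀ {l m} n {i j : Fin (l * (m * n))} →
  remQuot₃ {l} {m} n i ≡ remQuot₃ {l} {m} n j → i ≡ j
remQuot₃-injective {l} {m} n eq = remQuot-injective {l} (m * n)
  (cong₂ _,_ (cong proj₁ eq) (remQuot-injective {m} n (cong proj₂ eq)))

module _ (A B C H : ℕ) where

  private
    Box : ℕ
    Box = suc H * (suc H * suc H)

    Point : Set
    Point = Fin (suc H) × Fin (suc H) × Fin (suc H)

    coordinates : Fin Box → Point
    coordinates = remQuot₃ {suc H} {suc H} (suc H)

    -- All three signs are positive, so that the values lie between 0 and `(A + B + C) * H` and can
    -- be counted in ℕ. The sign of the third term is repaired when two values are subtracted.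
    form : Point → ℕ
    form (x , y , z) = A * toℕ x + B * toℕ y + C * toℕ z

    form≤ : ∀ u → form u ≤ (A + B + C) * H
    form≤ (x , y , z) = begin
      A * toℕ x + B * toℕ y + C * toℕ z
        ≤⟨ ℕ.+-mono-≤ (ℕ.+-mono-≤ (ℕ.*-monoʳ-≤ A (Fin.toℕ≤pred[n] x))
                                  (ℕ.*-monoʳ-≤ B (Fin.toℕ≤pred[n] y)))
                      (ℕ.*-monoʳ-≤ C (Fin.toℕ≤pred[n] z)) ⟩
      A * H + B * H + C * H               ≡⟨ distrib A B C H ⟩
      (A + B + C) * H                     ∎
      where
      open ℕ.≤-Reasoning
      distrib : ∀ a b c h → a * h + b * h + c * h ≡ (a + b + c) * h
      distrib = solve-∀

    ∣-∣≤ : ∀ (u w : Fin (suc H)) → ∣ + toℕ u ℤ.- + toℕ w ∣ ≤ H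
    ∣-∣≤ u w = begin
      ∣ + toℕ u ℤ.- + toℕ w ∣   ≡⟨ cong ∣_∣ (ℤ.m-n≡m⊖n (toℕ u) (toℕ w)) ⟩
      ∣ toℕ u ℤ.⊖ toℕ w ∣       ≤⟨ ℤ.∣m⊝n∣≤m⊔n (toℕ u) (toℕ w) ⟩
      toℕ u ⊔ toℕ w             ≤⟨ ℕ.⊔-lub (Fin.toℕ≤pred[n] u) (Fin.toℕ≤pred[n] w) ⟩
      H                         ∎
      where open ℕ.≤-Reasoning

    -≡0⇒≡ : ∀ (u w : Fin (suc H)) → + toℕ u ℤ.- + toℕ w ≡ 0ℤ → u ≡ w
    -≡0⇒≡ u w eq = Fin.toℕ-injective (ℤ.+-injective (ℤ.i-j≡0⇒i≡j (+ toℕ u) (+ toℕ w) eq))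

    form-difference : ∀ x y z x′ y′ z′ → form (x , y , z) ≡ form (x′ , y′ , z′) →
      + A ℤ.* (+ toℕ x ℤ.- + toℕ x′) ℤ.+ + B ℤ.* (+ toℕ y ℤ.- + toℕ y′)
        ≡ + C ℤ.* (+ toℕ z′ ℤ.- + toℕ z)
    form-difference x y z x′ y′ z′ eq = begin
      + A ℤ.* (+ toℕ x ℤ.- + toℕ x′) ℤ.+ + B ℤ.* (+ toℕ y ℤ.- + toℕ y′)
        ≡⟨ split (+ A) (+ B) (+ C) (+ toℕ x) (+ toℕ y) (+ toℕ z) (+ toℕ x′) (+ toℕ y′) (+ toℕ z′) ⟩
      ℤform x y z ℤ.- ℤform x′ y′ z′ ℤ.+ + C ℤ.* (+ toℕ z′ ℤ.- + toℕ z)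
        ≡⟨ cong (ℤ._+ + C ℤ.* (+ toℕ z′ ℤ.- + toℕ z))
                (ℤ.i≡j⇒i-j≡0
                  (trans (sym (cast x y z)) (trans (cong +_ eq) (cast x′ y′ z′)))) ⟩
      0ℤ ℤ.+ + C ℤ.* (+ toℕ z′ ℤ.- + toℕ z)
        ≡⟨ ℤ.+-identityˡ _ ⟩
      + C ℤ.* (+ toℕ z′ ℤ.- + toℕ z) ∎
      where
      open ≡-Reasoning
      ℤform : (x y z : Fin (suc H)) → ℤ
      ℤform x y z = + A ℤ.* + toℕ x ℤ.+ + B ℤ.* + toℕ y ℤ.+ + C ℤ.* + toℕ z
      cast : ∀ x y z → + form (x , y , z) ≡ ℤform x y z
      cast x y z = cong₂ ℤ._+_
        (cong₂ ℤ._+_ (ℤ.pos-* A (toℕ x)) (ℤ.pos-* B (toℕ y))) (ℤ.pos-* C (toℕ z))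
      split : ∀ a b c x y z x′ y′ z′ →
        a ℤ.* (x ℤ.- x′) ℤ.+ b ℤ.* (y ℤ.- y′)
          ≡ (a ℤ.* x ℤ.+ b ℤ.* y ℤ.+ c ℤ.* z) ℤ.- (a ℤ.* x′ ℤ.+ b ℤ.* y′ ℤ.+ c ℤ.* z′)
            ℤ.+ c ℤ.* (z′ ℤ.- z)
      split = ℤ-solve-∀

  -- With S = A + B + C, the form takes at most S H + 1 values on the (H + 1)³ points of the box.
  -- Since S < (H + 1)², two points collide, and their difference solves the equation with
  -- coordinates of size at most H.
  siegel : 0 < A + B + C → A + B + C < suc H * suc H →
    ∃[ x ] ∃[ y ] ∃[ z ] (+ A ℤ.* x ℤ.+ + B ℤ.* y ≡ + C ℤ.* z
      × (∣ x ∣ ≤ H × ∣ y ∣ ≤ H × ∣ z ∣ ≤ H)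
      × ¬ (x ≡ 0ℤ × y ≡ 0ℤ × z ≡ 0ℤ))
  siegel 0<S S<[1+H]² =
    let i , j , i<j , fi≡fj = Fin.pigeonhole holes<Box hole
        x  , y  , z  = coordinates i
        x′ , y′ , z′ = coordinates j
    -- The third difference is reversed because `C` stands on the other side of the equation.
    in + toℕ x ℤ.- + toℕ x′ , + toℕ y ℤ.- + toℕ y′ , + toℕ z′ ℤ.- + toℕ z
     , form-difference x y z x′ y′ z′
         (Fin.fromℕ<-injective _ _ (s≤s (form≤ (coordinates i))) (s≤s (form≤ (coordinates j))) fi≡fj)
     , (∣-∣≤ x x′ , ∣-∣≤ y y′ , ∣-∣≤ z′ z)
     , λ (x≡ , y≡ , z≡) → Fin.<⇒≢ i<j (remQuot₃-injective {suc H} {suc H} (suc H)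
         (cong₂ _,_ (-≡0⇒≡ x x′ x≡) (cong₂ _,_ (-≡0⇒≡ y y′ y≡) (sym (-≡0⇒≡ z′ z z≡)))))
    where
    hole : Fin Box → Fin (suc ((A + B + C) * H))
    hole i = fromℕ< (s≤s (form≤ (coordinates i)))

    holes<Box : suc ((A + B + C) * H) < Box
    holes<Box = begin-strict
      -- Positivity of the sum absorbs the extra 1 that comes from counting the value 0.
      suc ((A + B + C) * H)             ≤⟨ ℕ.+-monoˡ-≤ ((A + B + C) * H) 0<S ⟩
      (A + B + C) + (A + B + C) * H     ≡⟨ ℕ.*-suc (A + B + C) H ⟨
      (A + B + C) * suc H               <⟨ ℕ.*-monoˡ-< (suc H) S<[1+H]² ⟩
      suc H * suc H * suc H             ≡⟨ ℕ.*-assoc (suc H) (suc H) (suc H) ⟩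
      Box                               ∎
      where open ℕ.≤-Reasoning

-- Growth estimates: logarithms against powers, and the exponent ½ + ε.

n<2^n : ∀ n → n < 2 ^ n
n<2^n zero    = s≤s z≤n
n<2^n (suc n) = begin-strict
  suc n               ≡⟨ ℕ.+-comm 1 n ⟩
  n + 1               <⟨ ℕ.+-mono-<-≤ (n<2^n n) (ℕ.m^n>0 2 n) ⟩
  2 ^ n + 2 ^ n       ≡⟨ cong (λ m → 2 ^ n + m) (ℕ.+-identityʳ (2 ^ n)) ⟨
  2 ^ suc n           ∎
  where open ℕ.≤-Reasoning

^-distribʳ-* : ∀ m n o → (n * o) ^ m ≡ n ^ m * o ^ m
^-distribʳ-* zero    n o = refl
^-distribʳ-* (suc m) n o = begin
  n * o * (n * o) ^ m       ≡⟨ cong (n * o *_) (^-distribʳ-* m n o) ⟩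
  n * o * (n ^ m * o ^ m)   ≡⟨ ℕ.[m*n]*[o*p]≡[m*o]*[n*p] n o (n ^ m) (o ^ m) ⟩
  n ^ suc m * o ^ suc m     ∎
  where open ≡-Reasoning

-- With m = ⌊V / (t + 1)⌋ and P = 2 ^ m one has V ≤ (t + 1) P and P ^ (t + 1) ≤ c,
-- so V ^ t ≤ K P ^ t for K = (t + 1) ^ t; compare P with K.
log-power-< : ∀ t V {c} → 2 ^ V ≤ c → (suc t ^ t) ^ suc t < c → V ^ t < c
log-power-< t V {c} 2^V≤c K^1+t<c = ℕ.≤-<-trans V^t≤KP^t KP^t<c
  where
  open ℕ.≤-Reasoning
  m P K : ℕ
  m = V / suc t
  P = 2 ^ m
  K = suc t ^ t

  V≤ : V ≤ suc t * P
  V≤ = begin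
    V                         ≡⟨ m≡m%n+[m/n]*n V (suc t) ⟩
    V % suc t + m * suc t     ≤⟨ ℕ.+-monoˡ-≤ (m * suc t) (ℕ.<⇒≤ (m%n<n V (suc t))) ⟩
    suc m * suc t             ≤⟨ ℕ.*-monoˡ-≤ (suc t) (n<2^n m) ⟩
    P * suc t                 ≡⟨ ℕ.*-comm P (suc t) ⟩
    suc t * P                 ∎

  V^t≤KP^t : V ^ t ≤ K * P ^ t
  V^t≤KP^t = begin
    V ^ t             ≤⟨ ℕ.^-monoˡ-≤ t V≤ ⟩
    (suc t * P) ^ t   ≡⟨ ^-distribʳ-* t (suc t) P ⟩
    K * P ^ t         ∎

  instance
    P^t≢0 : NonZero (P ^ t)
    P^t≢0 = ℕ.m^n≢0 P t {{ℕ.m^n≢0 2 m}}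

  KP^t<c : K * P ^ t < c
  KP^t<c with K ℕ.<? P
  ... | yes K<P = begin-strict
    K * P ^ t         <⟨ ℕ.*-monoˡ-< (P ^ t) K<P ⟩
    P ^ suc t         ≡⟨ ℕ.^-*-assoc 2 m (suc t) ⟩
    2 ^ (m * suc t)   ≤⟨ ℕ.^-monoʳ-≤ 2 (m/n*n≤m V (suc t)) ⟩
    2 ^ V             ≤⟨ 2^V≤c ⟩
    c                 ∎
  ... | no  K≮P = begin-strict
    K * P ^ t         ≤⟨ ℕ.*-monoʳ-≤ K (ℕ.^-monoˡ-≤ t (ℕ.≮⇒≥ K≮P)) ⟩
    K ^ suc t         <⟨ K^1+t<c ⟩
    c                 ∎

square-cancel-< : ∀ {m n} → m * m < n * n → m < n
square-cancel-< m²<n² = ℕ.≰⇒> λ n≤m → ℕ.<⇒≱ m²<n² (ℕ.*-mono-≤ n≤m n≤m)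

-- Write q = k / t, so that t < 2k. Then M²ᵗ ≤ (c V)ᵗ = cᵗ Vᵗ < cᵗ⁺¹ ≤ c²ᵏ once c is large enough
-- for Vᵗ < c, and taking square roots gives Mᵗ < cᵏ.
sqrt-log-<^ℚ : ∀ q → ½ ℚ.< q → ∃[ N ] ∀ {V H c M} → N < c → 2 ^ V ≤ c →
  H * H ≤ c * V → M ≤ H → M < c ^ℚ q
sqrt-log-<^ℚ (mkℚ -[1+ _ ] _ _) (ℚ.*<* ())
-- The threshold is that of `log-power-<`; it depends only on the denominator of q, hence not on the
-- triple.
sqrt-log-<^ℚ (mkℚ (+ k) t-1 _) (ℚ.*<* t<2k) = (suc t ^ t) ^ suc t , M^t<c^k
  where
  open ℕ.≤-Reasoning
  t : ℕ
  t = suc t-1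

  t<k+k : t < k + k
  t<k+k = begin-strict
    t        ≡⟨ ℕ.*-identityˡ t ⟨
    1 * t    <⟨ ℤ.drop‿+<+ (subst (λ i → + (1 * t) ℤ.< i) (sym (ℤ.pos-* k 2)) t<2k) ⟩
    k * 2    ≡⟨ double k ⟩
    k + k    ∎
    where
    double : ∀ k → k * 2 ≡ k + k
    double = solve-∀

  M^t<c^k : ∀ {V H c M} → (suc t ^ t) ^ suc t < c → 2 ^ V ≤ c → H * H ≤ c * V → M ≤ H →
    M ^ t < c ^ k
  M^t<c^k {V} {H} {c@(suc _)} {M} N<c 2^V≤c H²≤cV M≤H = square-cancel-< (begin-strict
    M ^ t * M ^ t     ≡⟨ ^-distribʳ-* t M M ⟨
    (M * M) ^ t       ≤⟨ ℕ.^-monoˡ-≤ t (ℕ.≤-trans (ℕ.*-mono-≤ M≤H M≤H) H²≤cV) ⟩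
    (c * V) ^ t       ≡⟨ ^-distribʳ-* t c V ⟩
    c ^ t * V ^ t     <⟨ ℕ.*-monoʳ-< (c ^ t) {{ℕ.m^n≢0 c t}} (log-power-< t V 2^V≤c N<c) ⟩
    c ^ t * c         ≡⟨ ℕ.*-comm (c ^ t) c ⟩
    -- Over the integers t < 2k means t + 1 ≤ 2k, which leaves room for the one spare factor c.
    c ^ suc t         ≤⟨ ℕ.^-monoʳ-≤ c t<k+k ⟩
    c ^ (k + k)       ≡⟨ ℕ.^-distribˡ-+-* c k k ⟩
    c ^ k * c ^ k     ∎)

-- Roundedness of the cut of ε gives a rational r with 0 < r < ε, and q = r + ½ is a single exponent
-- that serves for all triples.
rational-exponent : ∀ ε → 0ℚ <ℝ ε → ∃[ q ] (½ ℚ.< q × q <ℝ ½ +ℝ ε)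
rational-exponent ε 0<ε =
  let r , 0<r , r<ε = Equivalence.to (ℝ.L-rounded ε 0ℚ) 0<ε
  in r ℚ.+ ½ , ℚ.+-monoˡ-< ½ 0<r , subst (ℝ.L ε) (sym (cancel r)) r<ε
  where
  cancel : ∀ r → (r ℚ.+ ½) ℚ.- ½ ≡ r
  -- The remaining `½ ℚ.- ½` reduces to `0ℚ` by computation.
  cancel r = trans (ℚ.+-assoc r ½ (ℚ.- ½)) (ℚ.+-identityʳ r)

-- Prime divisors, valuations and the coefficients of `d`.

prime-divisor : ∀ {n} → 1 < n → ∃[ p ] (value {P = Prime} p ∣ n)
prime-divisor {suc n} 1<n = go (factorise (suc n))
  where
  go : PrimeFactorisation (suc n) → ∃[ p ] (value {P = Prime} p ∣ suc n)
  go record { factors = []     ; isFactorisation = eq } = contradiction eq (ℕ.>⇒≢ 1<n)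
  go record { factors = p ∷ ps ; isFactorisation = eq ; factorsPrime = pr ∷ _ } =
    (p , [ pr ]) , subst (p ∣_) (sym eq) (m∣m*n _)

1<value : ∀ p → 1 < value p
-- The primality proof is irrelevant; as the inequality is decidable, a relevant proof can be
-- recomputed from it.
1<value (p , [ pr ]) = recompute (1 ℕ.<? p) (ℕ.nonTrivial⇒n>1 p {{prime⇒nonTrivial pr}})

maxPower-∣ : ∀ b p n → p ^ maxPower b p n ∣ n
maxPower-∣ zero    p n = 1∣ n
maxPower-∣ (suc b) p n with p ^ suc b ∣? n
... | yes pᵇ∣n = pᵇ∣n
... | no  _    = maxPower-∣ b p n

-- The search descends from `b` and stops at exponent 1 at the latest, where divisibility by p makes
-- the test succeed.
maxPower>0 : ∀ b p n → 0 < b → p ∣ n → 0 < maxPower b p n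
maxPower>0 (suc b) p n _ p∣n with p ^ suc b ∣? n
... | yes _ = s≤s z≤n
maxPower>0 (suc zero)    p n _ p∣n | no p¹∤n =
  contradiction (subst (_∣ n) (sym (ℕ.*-identityʳ p)) p∣n) p¹∤n
maxPower>0 (suc (suc b)) p n _ p∣n | no _ = maxPower>0 (suc b) p n (s≤s z≤n) p∣n

maxPower≡0 : ∀ b p n → p ∤ n → maxPower b p n ≡ 0
maxPower≡0 zero    p n p∤n = refl
maxPower≡0 (suc b) p n p∤n with p ^ suc b ∣? n
... | yes pᵇ∣n = contradiction (∣-trans (m∣m*n (p ^ b)) pᵇ∣n) p∤n
... | no  _    = maxPower≡0 b p n p∤n

-- This is v ≤ log₂ n stated without logarithms: p ≥ 2, and the power p ^ v divides n.
2^v≤n : ∀ p n .{{_ : NonZero n}} → 2 ^ v p n ≤ n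
2^v≤n p n = begin
  2 ^ v p n          ≤⟨ ℕ.^-monoˡ-≤ (v p n) (1<value p) ⟩
  value p ^ v p n    ≤⟨ ∣⇒≤ (maxPower-∣ n (value p) n) ⟩
  n                  ∎
  where open ℕ.≤-Reasoning

-- The coefficient `∂` at a natural number, kept in ℕ because `siegel` counts with natural
-- coefficients.
∂ℕ : ℕ → ℙ → ℕ
∂ℕ n p = _/_ (n * v p n) (value p) {{ℙ-nonZero p}}

∂-+ : ∀ n p → ∂ (+ n) p ≡ + ∂ℕ n p
∂-+ n p = cong (λ m → ℤ._/ℕ_ m (value p) {{ℙ-nonZero p}}) (sym (ℤ.pos-* n (v p n)))

∂ℕ-exact : ∀ n p → ∂ℕ n p * value p ≡ n * v p n
∂ℕ-exact n p = ℤ.+-injective (begin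
  + (∂ℕ n p * value p)        ≡⟨ ℤ.pos-* (∂ℕ n p) (value p) ⟩
  + ∂ℕ n p ℤ.* + value p      ≡⟨ cong (ℤ._* + value p) (∂-+ n p) ⟨
  ∂ (+ n) p ℤ.* + value p     ≡⟨ ∂-exact (+ n) p ⟩
  + n ℤ.* + v p n             ≡⟨ ℤ.pos-* n (v p n) ⟨
  + (n * v p n)               ∎)
  where open ≡-Reasoning

∂ℕ>0 : ∀ n p .{{_ : NonZero n}} → value p ∣ n → 0 < ∂ℕ n p
∂ℕ>0 n p p∣n = ℕ.n≢0⇒n>0 λ ∂≡0 →
  ℕ.>⇒≢ (ℕ.*-mono-< (ℕ.>-nonZero⁻¹ n) (maxPower>0 n (value p) n (ℕ.>-nonZero⁻¹ n) p∣n))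
        (trans (sym (∂ℕ-exact n p)) (cong (_* value p) ∂≡0))

-- The factor 2 gained from p ≥ 2 later cancels against a + b + c = 2c.
2*∂ℕ≤ : ∀ n p → 2 * ∂ℕ n p ≤ n * v p n
2*∂ℕ≤ n p = begin
  2 * ∂ℕ n p          ≡⟨ ℕ.*-comm 2 (∂ℕ n p) ⟩
  ∂ℕ n p * 2          ≤⟨ ℕ.*-monoʳ-≤ (∂ℕ n p) (1<value p) ⟩
  ∂ℕ n p * value p    ≡⟨ ∂ℕ-exact n p ⟩
  n * v p n           ∎
  where open ℕ.≤-Reasoning

∂-∤ : ∀ n p → value p ∤ n → ∂ (+ n) p ≡ 0ℤ
∂-∤ n p p∤n = trans (∂-+ n p) (cong +_ (ℕ.m*n≡0⇒m≡0 (∂ℕ n p) (value p) {{ℙ-nonZero p}}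
  (trans (∂ℕ-exact n p) (trans (cong (n *_) (maxPower≡0 n (value p) n p∤n)) (ℕ.*-zeroʳ n)))))

-- Functionals on `Ω` supported at three primes.

coeff-ξ-≡ : ∀ p → coeff (ξ p) p ≡ 1ℤ
coeff-ξ-≡ p = cong (if_then 1ℤ else 0ℤ) (dec-true (value p ℕ.≟ value p) refl)

coeff-ξ-≢ : ∀ p q → value p ≢ value q → coeff (ξ p) q ≡ 0ℤ
coeff-ξ-≢ p q p≢q = cong (if_then 1ℤ else 0ℤ) (dec-false (value q ℕ.≟ value p) (p≢q ∘ sym))

module Combination (p q r : ℙ)
  (p≢q : value p ≢ value q) (p≢r : value p ≢ value r) (q≢r : value q ≢ value r)
  (x y z : ℤ) where

  open LeftModuleMorphisms
    (LeftModule.rawLeftModule Ω)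
    (LeftModule.rawLeftModule (TensorUnit.leftModule {R = ℤ.+-*-ring}))
    using (IsLeftModuleHomomorphism)

  eval : ∣Ω∣ → ℤ
  eval ω = x ℤ.* coeff ω p ℤ.+ y ℤ.* coeff ω q ℤ.+ z ℤ.* coeff ω r

  eval-isLinear : IsLeftModuleHomomorphism eval
  eval-isLinear = record
    { +ᴹ-isGroupHomomorphism = record
      { isMonoidHomomorphism = record
        { isMagmaHomomorphism = record
          { isRelHomomorphism = record
            { cong = λ ω≈η → cong₂ ℤ._+_
                (cong₂ ℤ._+_ (cong (x ℤ.*_) (ω≈η p)) (cong (y ℤ.*_) (ω≈η q)))
                (cong (z ℤ.*_) (ω≈η r)) }
          ; homo = λ ω η →
              additive x y z (coeff ω p) (coeff η p) (coeff ω q) (coeff η q) (coeff ω r) (coeff η r)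
          }
        ; ε-homo = zeros x y z
        }
      ; ⁻¹-homo = λ ω → negative x y z (coeff ω p) (coeff ω q) (coeff ω r)
      }
    ; *ₗ-homo = λ k ω → scaled x y z k (coeff ω p) (coeff ω q) (coeff ω r)
    }
    where
    additive : ∀ x y z a a′ b b′ c c′ →
      x ℤ.* (a ℤ.+ a′) ℤ.+ y ℤ.* (b ℤ.+ b′) ℤ.+ z ℤ.* (c ℤ.+ c′)
        ≡ (x ℤ.* a ℤ.+ y ℤ.* b ℤ.+ z ℤ.* c) ℤ.+ (x ℤ.* a′ ℤ.+ y ℤ.* b′ ℤ.+ z ℤ.* c′)
    additive = ℤ-solve-∀
    zeros : ∀ x y z → x ℤ.* 0ℤ ℤ.+ y ℤ.* 0ℤ ℤ.+ z ℤ.* 0ℤ ≡ 0ℤ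
    zeros = ℤ-solve-∀
    negative : ∀ x y z a b c →
      x ℤ.* (ℤ.- a) ℤ.+ y ℤ.* (ℤ.- b) ℤ.+ z ℤ.* (ℤ.- c) ≡ ℤ.- (x ℤ.* a ℤ.+ y ℤ.* b ℤ.+ z ℤ.* c)
    negative = ℤ-solve-∀
    scaled : ∀ x y z k a b c →
      x ℤ.* (k ℤ.* a) ℤ.+ y ℤ.* (k ℤ.* b) ℤ.+ z ℤ.* (k ℤ.* c) ≡ k ℤ.* (x ℤ.* a ℤ.+ y ℤ.* b ℤ.+ z ℤ.* c)
    scaled = ℤ-solve-∀

  eval-p : ∀ ω → coeff ω q ≡ 0ℤ → coeff ω r ≡ 0ℤ → eval ω ≡ x ℤ.* coeff ω p
  eval-p ω ωq≡0 ωr≡0 rewrite ωq≡0 | ωr≡0 = drop x y z (coeff ω p)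
    where
    drop : ∀ x y z a → x ℤ.* a ℤ.+ y ℤ.* 0ℤ ℤ.+ z ℤ.* 0ℤ ≡ x ℤ.* a
    drop = ℤ-solve-∀

  eval-q : ∀ ω → coeff ω p ≡ 0ℤ → coeff ω r ≡ 0ℤ → eval ω ≡ y ℤ.* coeff ω q
  eval-q ω ωp≡0 ωr≡0 rewrite ωp≡0 | ωr≡0 = drop x y z (coeff ω q)
    where
    drop : ∀ x y z b → x ℤ.* 0ℤ ℤ.+ y ℤ.* b ℤ.+ z ℤ.* 0ℤ ≡ y ℤ.* b
    drop = ℤ-solve-∀

  eval-r : ∀ ω → coeff ω p ≡ 0ℤ → coeff ω q ≡ 0ℤ → eval ω ≡ z ℤ.* coeff ω r
  eval-r ω ωp≡0 ωq≡0 rewrite ωp≡0 | ωq≡0 = drop x y z (coeff ω r)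
    where
    drop : ∀ x y z c → x ℤ.* 0ℤ ℤ.+ y ℤ.* 0ℤ ℤ.+ z ℤ.* c ≡ z ℤ.* c
    drop = ℤ-solve-∀

  eval-ξ-p : eval (ξ p) ≡ x
  eval-ξ-p = trans (eval-p (ξ p) (coeff-ξ-≢ p q p≢q) (coeff-ξ-≢ p r p≢r))
                   (trans (cong (x ℤ.*_) (coeff-ξ-≡ p)) (ℤ.*-identityʳ x))

  eval-ξ-q : eval (ξ q) ≡ y
  eval-ξ-q = trans (eval-q (ξ q) (coeff-ξ-≢ q p (p≢q ∘ sym)) (coeff-ξ-≢ q r q≢r))
                   (trans (cong (y ℤ.*_) (coeff-ξ-≡ q)) (ℤ.*-identityʳ y))

  eval-ξ-r : eval (ξ r) ≡ z
  eval-ξ-r = trans (eval-r (ξ r) (coeff-ξ-≢ r p (p≢r ∘ sym)) (coeff-ξ-≢ r q (q≢r ∘ sym)))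
                   (trans (cong (z ℤ.*_) (coeff-ξ-≡ r)) (ℤ.*-identityʳ z))

  eval-ξ-≢ : ∀ s → value s ≢ value p → value s ≢ value q → value s ≢ value r → eval (ξ s) ≡ 0ℤ
  eval-ξ-≢ s s≢p s≢q s≢r =
    trans (eval-p (ξ s) (coeff-ξ-≢ s q s≢q) (coeff-ξ-≢ s r s≢r))
          (trans (cong (x ℤ.*_) (coeff-ξ-≢ s p s≢p)) (ℤ.*-zeroʳ x))

  norm : ℕ
  norm = ∣ x ∣ ⊔ (∣ y ∣ ⊔ ∣ z ∣)

  -- The case analysis on s is done once here; both the norm bound and the support condition follow
  -- from it.
  eval-ξ-elim : (P : ℙ → ℤ → Set) → P p x → P q y → P r z → (∀ s → P s 0ℤ) →
    ∀ s → P s (eval (ξ s))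
  -- Splitting s into number and irrelevant proof lets `refl` between numbers identify the primes
  -- themselves.
  eval-ξ-elim P Pp Pq Pr P0 s@(_ , _)
    with value s ℕ.≟ value p | value s ℕ.≟ value q | value s ℕ.≟ value r
  ... | yes refl | _        | _        = subst (P p) (sym eval-ξ-p) Pp
  ... | no _     | yes refl | _        = subst (P q) (sym eval-ξ-q) Pq
  ... | no _     | no _     | yes refl = subst (P r) (sym eval-ξ-r) Pr
  ... | no s≢p   | no s≢q   | no s≢r   = subst (P s) (sym (eval-ξ-≢ s s≢p s≢q s≢r)) (P0 s)

  eval-ξ≤norm : ∀ s → ∣ eval (ξ s) ∣ ≤ norm
  eval-ξ≤norm = eval-ξ-elim (λ _ w → ∣ w ∣ ≤ norm)
    (ℕ.m≤m⊔n ∣ x ∣ (∣ y ∣ ⊔ ∣ z ∣))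
    (ℕ.≤-trans (ℕ.m≤m⊔n ∣ y ∣ ∣ z ∣) (ℕ.m≤n⊔m ∣ x ∣ (∣ y ∣ ⊔ ∣ z ∣)))
    (ℕ.≤-trans (ℕ.m≤n⊔m ∣ y ∣ ∣ z ∣) (ℕ.m≤n⊔m ∣ x ∣ (∣ y ∣ ⊔ ∣ z ∣)))
    (λ _ → z≤n)

  ψ : 𝒯
  ψ = record { ⟦_⟧ = eval ; isLinear = eval-isLinear ; bounded = norm , eval-ξ≤norm }

  -- The values x, y, z are attained at p, q, r, so every upper bound dominates their maximum.
  ‖ψ‖≡norm : ‖ ψ ‖≡ norm
  ‖ψ‖≡norm = eval-ξ≤norm , λ M ub →
    ℕ.⊔-lub (subst (λ w → ∣ w ∣ ≤ M) eval-ξ-p (ub p))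
      (ℕ.⊔-lub (subst (λ w → ∣ w ∣ ≤ M) eval-ξ-q (ub q))
               (subst (λ w → ∣ w ∣ ≤ M) eval-ξ-r (ub r)))

-- Coprime triples: the linear equation and the size of its solution.

module _ (a b c : ℕ) (1<a : 1 < a) (1<b : 1 < b) (1<c : 1 < c)
  (coprime : gcd a (gcd b c) ≡ 1) (a+b≡c : a + b ≡ c) where

  private
    instance
      a≢0 : NonZero a
      a≢0 = ℕ.>-nonZero (ℕ.<⇒≤ 1<a)
      b≢0 : NonZero b
      b≢0 = ℕ.>-nonZero (ℕ.<⇒≤ 1<b)
      c≢0 : NonZero c
      c≢0 = ℕ.>-nonZero (ℕ.<⇒≤ 1<c)

    no-common : ∀ p → value p ∣ a → value p ∣ b → value p ∤ c
    no-common p p∣a p∣b p∣c = ℕ.<⇒≱ (1<value p)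
      (∣⇒≤ (subst (value p ∣_) coprime (gcd-greatest p∣a (gcd-greatest p∣b p∣c))))

    -- By a + b = c, a prime dividing two of the three numbers divides the third, so joint
    -- coprimality becomes pairwise here and in the next two lemmas.
    ∣a⇒∤b : ∀ p → value p ∣ a → value p ∤ b
    ∣a⇒∤b p p∣a p∣b = no-common p p∣a p∣b (subst (value p ∣_) a+b≡c (∣m∣n⇒∣m+n p∣a p∣b))

    ∣a⇒∤c : ∀ p → value p ∣ a → value p ∤ c
    ∣a⇒∤c p p∣a p∣c = no-common p p∣a
      (∣m+n∣m⇒∣n (subst (value p ∣_) (sym a+b≡c) p∣c) p∣a) p∣c

    ∣b⇒∤c : ∀ p → value p ∣ b → value p ∤ c
    ∣b⇒∤c p p∣b p∣c = no-common p
      (∣m+n∣m⇒∣n (subst (value p ∣_) (trans (sym a+b≡c) (ℕ.+-comm a b)) p∣c) p∣b) p∣b p∣c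

  module _ (p q r : ℙ) (p∣a : value p ∣ a) (q∣b : value q ∣ b) (r∣c : value r ∣ c) where

    private
      p≢q : value p ≢ value q
      p≢q p≡q = ∣a⇒∤b p p∣a (subst (_∣ b) (sym p≡q) q∣b)
      p≢r : value p ≢ value r
      p≢r p≡r = ∣a⇒∤c p p∣a (subst (_∣ c) (sym p≡r) r∣c)
      q≢r : value q ≢ value r
      q≢r q≡r = ∣b⇒∤c q q∣b (subst (_∣ c) (sym q≡r) r∣c)

      -- One bound for the three valuations that still satisfies 2 ^ V ≤ c; it plays the part of
      -- log₂ c.
      V : ℕ
      V = v p a ⊔ (v q b ⊔ v r c)

      a≤c : a ≤ c
      a≤c = subst (a ≤_) a+b≡c (ℕ.m≤m+n a b)
      b≤c : b ≤ c
      b≤c = subst (b ≤_) a+b≡c (ℕ.m≤n+m b a)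

      2^-⊔ : ∀ m n → 2 ^ m ≤ c → 2 ^ n ≤ c → 2 ^ (m ⊔ n) ≤ c
      2^-⊔ m n 2^m≤c 2^n≤c = subst (_≤ c)
        (sym (ℕ.mono-≤-distrib-⊔ (ℕ.^-monoʳ-≤ 2) m n)) (ℕ.⊔-lub 2^m≤c 2^n≤c)

      2^V≤c : 2 ^ V ≤ c
      2^V≤c = 2^-⊔ (v p a) (v q b ⊔ v r c) (ℕ.≤-trans (2^v≤n p a) a≤c)
                   (2^-⊔ (v q b) (v r c) (ℕ.≤-trans (2^v≤n q b) b≤c) (2^v≤n r c))

      -- Twice the left side is at most (a + b + c) V, which equals 2 c V.
      S≤cV : ∂ℕ a p + ∂ℕ b q + ∂ℕ c r ≤ c * V
      S≤cV = ℕ.*-cancelˡ-≤ 2 (begin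
        2 * (∂ℕ a p + ∂ℕ b q + ∂ℕ c r)
          ≡⟨ distrib (∂ℕ a p) (∂ℕ b q) (∂ℕ c r) ⟩
        2 * ∂ℕ a p + 2 * ∂ℕ b q + 2 * ∂ℕ c r
          ≤⟨ ℕ.+-mono-≤ (ℕ.+-mono-≤ (2*∂ℕ≤ a p) (2*∂ℕ≤ b q)) (2*∂ℕ≤ c r) ⟩
        a * v p a + b * v q b + c * v r c
          ≤⟨ ℕ.+-mono-≤ (ℕ.+-mono-≤
               (ℕ.*-monoʳ-≤ a (ℕ.m≤m⊔n (v p a) (v q b ⊔ v r c)))
               (ℕ.*-monoʳ-≤ b (ℕ.≤-trans (ℕ.m≤m⊔n (v q b) (v r c)) (ℕ.m≤n⊔m (v p a) _))))
               (ℕ.*-monoʳ-≤ c (ℕ.≤-trans (ℕ.m≤n⊔m (v q b) (v r c)) (ℕ.m≤n⊔m (v p a) _))) ⟩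
        a * V + b * V + c * V
          ≡⟨ cong (_+ c * V) (trans (sym (ℕ.*-distribʳ-+ V a b)) (cong (_* V) a+b≡c)) ⟩
        c * V + c * V
          ≡⟨ cong (λ m → c * V + m) (ℕ.+-identityʳ (c * V)) ⟨
        2 * (c * V) ∎)
        where
        open ℕ.≤-Reasoning
        distrib : ∀ a b c → 2 * (a + b + c) ≡ 2 * a + 2 * b + 2 * c
        distrib = solve-∀

    module Solution (x y z : ℤ) (Ax+By≡Cz : + ∂ℕ a p ℤ.* x ℤ.+ + ∂ℕ b q ℤ.* y ≡ + ∂ℕ c r ℤ.* z)
      (nonzero : ¬ (x ≡ 0ℤ × y ≡ 0ℤ × z ≡ 0ℤ)) where

      open Combination p q r p≢q p≢r q≢r x y z public

      supp⊆ : ∀ {s} → supp𝒯 ψ s → supp (+ (a * b * (a + b))) s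
      supp⊆ {s} = eval-ξ-elim (λ s w → w ≢ 0ℤ → value s ∣ a * b * (a + b))
        (λ _ → ∣m⇒∣m*n (a + b) (∣m⇒∣m*n b p∣a))
        (λ _ → ∣m⇒∣m*n (a + b) (∣n⇒∣m*n a q∣b))
        (λ _ → ∣n⇒∣m*n (a * b) (subst (value r ∣_) (sym a+b≡c) r∣c))
        (λ _ 0≢0 → contradiction refl 0≢0) s

      -- Pairwise coprimality makes each of a, b, c see only its own prime, so each derivative is a
      -- single product.
      d-a : d[ ψ ] (+ a) ≡ x ℤ.* + ∂ℕ a p
      d-a = trans (eval-p (d (+ a)) (∂-∤ a q λ q∣a → ∣a⇒∤b q q∣a q∣b)
                                  (∂-∤ a r λ r∣a → ∣a⇒∤c r r∣a r∣c))
                  (cong (x ℤ.*_) (∂-+ a p))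

      d-b : d[ ψ ] (+ b) ≡ y ℤ.* + ∂ℕ b q
      d-b = trans (eval-q (d (+ b)) (∂-∤ b p (∣a⇒∤b p p∣a)) (∂-∤ b r λ r∣b → ∣b⇒∤c r r∣b r∣c))
                  (cong (y ℤ.*_) (∂-+ b q))

      d-c : d[ ψ ] (+ c) ≡ z ℤ.* + ∂ℕ c r
      d-c = trans (eval-r (d (+ c)) (∂-∤ c p (∣a⇒∤c p p∣a)) (∂-∤ c q (∣b⇒∤c q q∣b)))
                  (cong (z ℤ.*_) (∂-+ c r))

      additive : d[ ψ ] (+ (a + b)) ≡ d[ ψ ] (+ a) ℤ.+ d[ ψ ] (+ b)
      additive = begin
        d[ ψ ] (+ (a + b))                        ≡⟨ cong (λ n → d[ ψ ] (+ n)) a+b≡c ⟩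
        d[ ψ ] (+ c)                              ≡⟨ d-c ⟩
        z ℤ.* + ∂ℕ c r                            ≡⟨ ℤ.*-comm z (+ ∂ℕ c r) ⟩
        + ∂ℕ c r ℤ.* z                            ≡⟨ Ax+By≡Cz ⟨
        + ∂ℕ a p ℤ.* x ℤ.+ + ∂ℕ b q ℤ.* y
          ≡⟨ cong₂ ℤ._+_ (ℤ.*-comm (+ ∂ℕ a p) x) (ℤ.*-comm (+ ∂ℕ b q) y) ⟩
        x ℤ.* + ∂ℕ a p ℤ.+ y ℤ.* + ∂ℕ b q         ≡⟨ cong₂ ℤ._+_ d-a d-b ⟨
        d[ ψ ] (+ a) ℤ.+ d[ ψ ] (+ b)             ∎
        where open ≡-Reasoning

      cancel : ∀ {w D} → 0 < D → w ℤ.* + D ≡ 0ℤ → w ≡ 0ℤ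
      cancel {w} {D} 0<D wD≡0 with ℤ.i*j≡0⇒i≡0∨j≡0 w wD≡0
      ... | inj₁ w≡0 = w≡0
      ... | inj₂ D≡0 = contradiction (ℤ.+-injective D≡0) (ℕ.>⇒≢ 0<D)

      -- The coefficients are positive, so vanishing of all three derivatives would force x = y = z
      -- = 0.
      nonvanishing : ¬ (d[ ψ ] (+ a) ≡ 0ℤ × d[ ψ ] (+ b) ≡ 0ℤ × d[ ψ ] (+ c) ≡ 0ℤ)
      nonvanishing (da≡0 , db≡0 , dc≡0) = nonzero
        ( cancel (∂ℕ>0 a p p∣a) (trans (sym d-a) da≡0)
        , cancel (∂ℕ>0 b q q∣b) (trans (sym d-b) db≡0)
        , cancel (∂ℕ>0 c r r∣c) (trans (sym d-c) dc≡0) )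

    -- Only the two inequalities on `V` and `H` are exported, which is the form of input that
    -- `sqrt-log-<^ℚ` takes.
    bounded-solution : ∃[ V ] ∃[ H ] (2 ^ V ≤ c × H * H ≤ c * V
      × ∃[ ψ ] (𝒯⟨ a , b ⟩ ψ × (∃[ M ] (‖ ψ ‖≡ M × M ≤ H))
        × ¬ (d[ ψ ] (+ a) ≡ 0ℤ × d[ ψ ] (+ b) ≡ 0ℤ × d[ ψ ] (+ c) ≡ 0ℤ)))
    bounded-solution =
      let H , H²≤S , S<[1+H]² = isqrt (∂ℕ a p + ∂ℕ b q + ∂ℕ c r)
          x , y , z , Ax+By≡Cz , (∣x∣≤H , ∣y∣≤H , ∣z∣≤H) , nonzero =
            siegel (∂ℕ a p) (∂ℕ b q) (∂ℕ c r) H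
              (ℕ.≤-trans (∂ℕ>0 c r r∣c) (ℕ.m≤n+m (∂ℕ c r) (∂ℕ a p + ∂ℕ b q))) S<[1+H]²
          module S = Solution x y z Ax+By≡Cz nonzero
      in V , H , 2^V≤c , ℕ.≤-trans H²≤S S≤cV
       , S.ψ , ((λ {s} → S.supp⊆ {s}) , S.additive)
       , (S.norm , S.‖ψ‖≡norm , ℕ.⊔-lub ∣x∣≤H (ℕ.⊔-lub ∣y∣≤H ∣z∣≤H))
       , S.nonvanishing

theorem2p8 : (ε : ℝ) → 0ℚ <ℝ ε →
    Σ[ exceptions ∈ List (ℕ × ℕ × ℕ) ] ((a b c : ℕ) → 1 < a → 1 < b → 1 < c →
    gcd a (gcd b c) ≡ 1 → a + b ≡ c →
    (a , b , c) ∉ exceptions →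
    ∃[ ψ ] (𝒯⟨ a , b ⟩ ψ
    × (∃[ M ] (‖ ψ ‖≡ M × M < c ^ℝ ½ +ℝ ε))
    × ¬ (d[ ψ ] (+ a) ≡ 0ℤ × d[ ψ ] (+ b) ≡ 0ℤ × d[ ψ ] (+ c) ≡ 0ℤ)))
theorem2p8 ε 0<ε
  -- The exponent and the threshold are fixed before any triple is considered, since the exceptions
  -- may depend only on ε.
  with e , ½<e , e<½+ε ← rational-exponent ε 0<ε
  with N , small ← sqrt-log-<^ℚ e ½<e
  -- The exceptions are the triples with entries from 0 to N. As a and b are at most c, a triple
  -- outside this list has c > N.
  = cartesianProduct (upTo (suc N)) (cartesianProduct (upTo (suc N)) (upTo (suc N)))
  , λ a b c 1<a 1<b 1<c coprime a+b≡c ∉exceptions →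
      let N<c = ℕ.≰⇒> λ c≤N → ∉exceptions (∈-cartesianProduct⁺
            (∈-upTo⁺ (s≤s (ℕ.≤-trans (subst (a ≤_) a+b≡c (ℕ.m≤m+n a b)) c≤N)))
            (∈-cartesianProduct⁺
              (∈-upTo⁺ (s≤s (ℕ.≤-trans (subst (b ≤_) a+b≡c (ℕ.m≤n+m b a)) c≤N)))
              (∈-upTo⁺ (s≤s c≤N))))
          p , p∣a = prime-divisor 1<a
          q , q∣b = prime-divisor 1<b
          r , r∣c = prime-divisor 1<c
          V , H , 2^V≤c , H²≤cV , ψ , ψ∈𝒯 , (M , ‖ψ‖≡M , M≤H) , nonvanishing =
            bounded-solution a b c 1<a 1<b 1<c coprime a+b≡c p q r p∣a q∣b r∣c
      in ψ , ψ∈𝒯 , (M , ‖ψ‖≡M , e , e<½+ε , small {V} N<c 2^V≤c H²≤cV M≤H) , nonvanishing
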